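{- For every integer $n\ge 0$, $$F_{n+1}(x)=x\sum_{k=0}^{n}\binom{n}{k}\left[F_{k}(x)+xF_{k}'(x)\right],$$ where $F_k'(x)$ denotes the first derivative of the geometric polynomial $F_k(x)$ with respect to $x$.
   Context: For integers $n,k\ge 0$, ${n\brace k}$ denotes the Stirling number of the second kind, defined by $\sum_{n=0}^{\infty}{n\brace k}\frac{x^n}{n!}=\frac{(e^x-1)^k}{k!}$. The $n$-th geometric (Fubini) polynomial is $F_n(x)=\sum_{k=0}^{n}{n\brace k}k!\,x^k$ (so $F_0(x)=1$, $F_1(x)=x$, $F_2(x)=x+2x^2$). -}

module Defs where

open import Algebra.Bundles.Raw using (RawSemiring)
import Algebra.Definitions.RawSemiring as RawSemiringDefs
open import Data.Fin.Base using (toℕ)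
open import Data.Integer.Base as ℤ using (+_)
import Data.Integer.Properties as ℤ
open import Data.List.Base using (List; []; _∷_; map)
open import Data.Nat.Base as ℕ using (ℕ; zero; suc; _∸_; _!)
open import Data.Nat.Properties using (_!≢0; *-identityˡ)
open import Data.Rational.Base as ℚ using (ℚ; 0ℚ; 1ℚ; _/_; fromℚᵘ; toℚᵘ)
import Data.Rational.Properties as ℚ
open import Data.Rational.Unnormalised.Base as ℚᵘ using (mkℚᵘ; *≡*)
import Data.Rational.Unnormalised.Properties as ℚᵘ
open import Level using (0ℓ)
open import Relation.Binary.PropositionalEquality

fromℕ : ℕ → ℚ
fromℕ n = + n / 1

1/! : ℕ → ℚ
1/! n = (+ 1 / n !) {{n !≢0}}

module ℚ-Sum = RawSemiringDefs ℚ.+-*-rawSemiring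

-- Formal power series over ℚ: f n is the coefficient of xⁿ.

Series : Set
Series = ℕ → ℚ

module Series where

  infix  4 _≈_
  infixl 6 _+_ _-_
  infixl 7 _*_
  infixr 8 _·_

  _≈_ : Series → Series → Set
  f ≈ g = ∀ n → f n ≡ g n

  0# 1# : Series
  0# _       = 0ℚ
  1# zero    = 1ℚ
  1# (suc _) = 0ℚ

  _+_ _-_ _*_ : Series → Series → Series
  (f + g) n = f n ℚ.+ g n
  (f - g) n = f n ℚ.- g n
  (f * g) n = ℚ-Sum.sum {suc n} λ i → f (toℕ i) ℚ.* g (n ∸ toℕ i)

  _·_ : ℚ → Series → Series
  (c · f) n = c ℚ.* f n

  rawSemiring : RawSemiring 0ℓ 0ℓ
  rawSemiring = record
    { _≈_ = _≈_ ; _+_ = _+_ ; _*_ = _*_ ; 0# = 0# ; 1# = 1# }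

  open RawSemiringDefs rawSemiring public using (_^_)

  exp : Series
  exp = 1/!

-- The series (eˣ - 1)ᵏ / k!.

stirlingEGF : ℕ → Series
stirlingEGF k = 1/! k Series.· (Series.exp Series.- Series.1#) Series.^ k

-- The Stirling number {n k} is n! times the coefficient of xⁿ in (eˣ - 1)ᵏ / k!,
-- so it is rational by construction.

stirling : ℕ → ℕ → ℚ
stirling n k = fromℕ (n !) ℚ.* stirlingEGF k n

-- Polynomials over ℚ: the list of coefficients, constant term first. Trailing
-- zeros are allowed, so equality is coefficientwise.

Poly : Set
Poly = List ℚ

coeff : Poly → ℕ → ℚ
coeff []      _       = 0ℚ
coeff (a ∷ _) zero    = a
coeff (_ ∷ p) (suc i) = coeff p i

module Poly where

  infix  4 _≈_
  infixl 6 _+_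
  infixl 7 _*_
  infixr 8 _·_

  _≈_ : Poly → Poly → Set
  p ≈ q = ∀ i → coeff p i ≡ coeff q i

  0# 1# X : Poly
  0# = []
  1# = 1ℚ ∷ []
  X  = 0ℚ ∷ 1ℚ ∷ []

  _+_ : Poly → Poly → Poly
  []      + q       = q
  (a ∷ p) + []      = a ∷ p
  (a ∷ p) + (b ∷ q) = (a ℚ.+ b) ∷ (p + q)

  _·_ : ℚ → Poly → Poly
  c · p = map (c ℚ.*_) p

  _*_ : Poly → Poly → Poly
  []      * q = []
  (a ∷ p) * q = a · q + (0ℚ ∷ p * q)

  rawSemiring : RawSemiring 0ℓ 0ℓ
  rawSemiring = record
    { _≈_ = _≈_ ; _+_ = _+_ ; _*_ = _*_ ; 0# = 0# ; 1# = 1# }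

  open RawSemiringDefs rawSemiring public using (_^_; sum)

  ∑≤ : ℕ → (ℕ → Poly) → Poly
  ∑≤ n f = sum {suc n} λ i → f (toℕ i)

  infix 5 ∑≤
  syntax ∑≤ n (λ k → p) = ∑[ k ≤ n ] p

  -- diffFrom m (a₀ ∷ a₁ ∷ …) = m a₀ ∷ (m + 1) a₁ ∷ …

  diffFrom : ℕ → Poly → Poly
  diffFrom m []      = []
  diffFrom m (a ∷ p) = fromℕ m ℚ.* a ∷ diffFrom (suc m) p

  derivative : Poly → Poly
  derivative []      = []
  derivative (_ ∷ p) = diffFrom 1 p

F : ℕ → Poly
F n = ∑[ k ≤ n ] (stirling n k ℚ.* fromℕ (k !)) · X ^ k
  where open Poly

F′ : ℕ → Poly
F′ n = Poly.derivative (F n)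

1/!-inverse : ∀ n → fromℕ (n !) ℚ.* 1/! n ≡ 1ℚ
1/!-inverse n = lemma (n !) {{n !≢0}}
  where
  lemma : ∀ m .{{_ : ℕ.NonZero m}} → fromℕ m ℚ.* (+ 1 / m) ≡ 1ℚ
  lemma m@(suc d) = ℚ.toℚᵘ-injective (begin
    toℚᵘ (fromℕ m ℚ.* (+ 1 / m))               ≈⟨ ℚ.toℚᵘ-homo-* (fromℕ m) (+ 1 / m) ⟩
    toℚᵘ (fromℕ m) ℚᵘ.* toℚᵘ (+ 1 / m)         ≈⟨ ℚᵘ.*-cong (ℚ.toℚᵘ-fromℚᵘ (mkℚᵘ (+ m) 0))
                                                            (ℚ.toℚᵘ-fromℚᵘ (mkℚᵘ (+ 1) d)) ⟩
    mkℚᵘ (+ m) 0 ℚᵘ.* mkℚᵘ (+ 1) d             ≈⟨ *≡* (trans (ℤ.*-identityʳ (+ m ℤ.* + 1))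
                                                        (trans (ℤ.*-comm (+ m) (+ 1))
                                                          (cong (λ k → + 1 ℤ.* (+ k)) (sym (*-identityˡ m))))) ⟩
    toℚᵘ 1ℚ                                    ∎)
    where
    open import Relation.Binary.Reasoning.Setoid ℚᵘ.≃-setoid

-- The defining identity ∑ₙ {n k} xⁿ / n! = (eˣ - 1)ᵏ / k!.

stirling-egf : ∀ k → (λ n → stirling n k ℚ.* 1/! n) Series.≈ stirlingEGF k
stirling-egf k n = begin
  fromℕ (n !) ℚ.* c ℚ.* 1/! n   ≡⟨ cong (ℚ._* 1/! n) (ℚ.*-comm (fromℕ (n !)) c) ⟩
  c ℚ.* fromℕ (n !) ℚ.* 1/! n   ≡⟨ ℚ.*-assoc c (fromℕ (n !)) (1/! n) ⟩
  c ℚ.* (fromℕ (n !) ℚ.* 1/! n) ≡⟨ cong (c ℚ.*_) (1/!-inverse n) ⟩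
  c ℚ.* 1ℚ                      ≡⟨ ℚ.*-identityʳ c ⟩
  c                             ∎
  where
  open ≡-Reasoning
  c = stirlingEGF k n

{-# OPTIONS --safe #-}

-- With E = eˣ - 1, the coefficient of xᵏ in Fₙ is n! [xⁿ] Eᵏ, for every k because Eᵏ
-- has order at least k. Since E′ = eˣ = E + 1, the Leibniz rule gives
-- (Eʲ⁺¹)′ = (j + 1) eˣ Eʲ. Multiplying by n!, the coefficients of xⁿ on both sides are
-- the coefficients of xʲ⁺¹ in Fₙ₊₁ and, the product with eˣ being a binomial
-- convolution, in the right-hand side: p + x p′ multiplies the j-th coefficient of p
-- by j + 1.

module Submission where

open import Defs
open import Data.Fin.Base using (Fin; zero; suc; toℕ)
open import Data.Fin.Permutation using (reverse)
open import Data.Fin.Properties using (toℕ<n; toℕ-fromℕ; toℕ-inject₁; opposite-prop)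
open import Data.Integer.Base as ℤ using (+_)
import Data.Integer.Properties as ℤ
open import Data.List.Base using ([]; _∷_)
open import Data.Nat.Base as ℕ using (ℕ; zero; suc; _∸_; _!; _≤_; _<_; z≤n; s≤s; s≤s⁻¹)
open import Data.Nat.Combinatorics using (_C_; nCk≡n!/k![n-k]!; k![n∸k]!∣n!)
import Data.Nat.DivMod as ℕ
import Data.Nat.Properties as ℕ
open import Data.Rational.Base as ℚ using (ℚ; 0ℚ; 1ℚ; toℚᵘ)
import Data.Rational.Properties as ℚ
open import Data.Rational.Solver using (module +-*-Solver)
open +-*-Solver using (solve; con; _:=_; _:+_; _:*_; _:-_)
open import Data.Rational.Unnormalised.Base as ℚᵘ using (mkℚᵘ; *≡*)
import Data.Rational.Unnormalised.Properties as ℚᵘ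
open import Data.Vec.Functional using (Vector; tail; init; last)
open import Function.Base using (_∘_)
open import Relation.Binary.PropositionalEquality

open import Algebra.Bundles using (CommutativeRing)
open import Algebra.Properties.Semiring.Sum
  (CommutativeRing.semiring ℚ.+-*-commutativeRing)
  using (sum; sum-cong-≗; sum-init-last; sum-replicate-zero; ∑-distrib-+; sum-permute;
         *-distribˡ-sum)

open Defs using () renaming (fromℕ to ⟦_⟧)

-- Natural numbers and factorials inside ℚ.

module _ where
  open import Data.Rational.Base using (_+_; _*_)
  open ≡-Reasoning

  toℚᵘ-⟦⟧ : ∀ n → toℚᵘ ⟦ n ⟧ ℚᵘ.≃ mkℚᵘ (+ n) 0
  toℚᵘ-⟦⟧ n = ℚ.toℚᵘ-fromℚᵘ (mkℚᵘ (+ n) 0)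

  ⟦⟧-homo-+ : ∀ m n → ⟦ m ℕ.+ n ⟧ ≡ ⟦ m ⟧ + ⟦ n ⟧
  ⟦⟧-homo-+ m n = ℚ.toℚᵘ-injective (
    ℚᵘ.≃-trans (toℚᵘ-⟦⟧ (m ℕ.+ n)) (ℚᵘ.≃-trans
      (*≡* (cong (ℤ._* + 1) (sym (cong₂ ℤ._+_ (ℤ.*-identityʳ (+ m)) (ℤ.*-identityʳ (+ n))))))
      (ℚᵘ.≃-sym (ℚᵘ.≃-trans (ℚ.toℚᵘ-homo-+ ⟦ m ⟧ ⟦ n ⟧)
        (ℚᵘ.+-cong (toℚᵘ-⟦⟧ m) (toℚᵘ-⟦⟧ n))))))

  ⟦⟧-homo-* : ∀ m n → ⟦ m ℕ.* n ⟧ ≡ ⟦ m ⟧ * ⟦ n ⟧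
  ⟦⟧-homo-* m n = ℚ.toℚᵘ-injective (
    ℚᵘ.≃-trans (toℚᵘ-⟦⟧ (m ℕ.* n)) (ℚᵘ.≃-trans
      (*≡* (cong (ℤ._* + 1) (ℤ.pos-* m n)))
      (ℚᵘ.≃-sym (ℚᵘ.≃-trans (ℚ.toℚᵘ-homo-* ⟦ m ⟧ ⟦ n ⟧)
        (ℚᵘ.*-cong (toℚᵘ-⟦⟧ m) (toℚᵘ-⟦⟧ n))))))

  -- The coefficient form of (eˣ)′ = eˣ. Inserting 1 = n! · (1/n!) lets (n + 1) · n! cancel against
  -- 1/(n + 1)!.
  suc*1/! : ∀ n → ⟦ suc n ⟧ * 1/! (suc n) ≡ 1/! n
  suc*1/! n = begin
    ⟦ suc n ⟧ * 1/! (suc n)                          ≡⟨ ℚ.*-identityˡ _ ⟨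
    1ℚ * (⟦ suc n ⟧ * 1/! (suc n))                   ≡⟨ cong (_* (⟦ suc n ⟧ * 1/! (suc n))) (1/!-inverse n) ⟨
    ⟦ n ! ⟧ * 1/! n * (⟦ suc n ⟧ * 1/! (suc n))
      ≡⟨ solve 4 (λ a b c d → a :* b :* (c :* d) := b :* (c :* a :* d)) refl
           ⟦ n ! ⟧ (1/! n) ⟦ suc n ⟧ (1/! (suc n)) ⟩
    1/! n * (⟦ suc n ⟧ * ⟦ n ! ⟧ * 1/! (suc n))      ≡⟨ cong (λ a → 1/! n * (a * 1/! (suc n))) (⟦⟧-homo-* (suc n) (n !)) ⟨
    1/! n * (⟦ suc n ! ⟧ * 1/! (suc n))              ≡⟨ cong (1/! n *_) (1/!-inverse (suc n)) ⟩
    1/! n * 1ℚ                                       ≡⟨ ℚ.*-identityʳ _ ⟩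
    1/! n                                            ∎

  C*k!*[n∸k]!≡n! : ∀ {n k} → k ≤ n → (n C k) ℕ.* (k ! ℕ.* (n ∸ k) !) ≡ n !
  C*k!*[n∸k]!≡n! {n} {k} k≤n = trans
    (cong (ℕ._* (k ! ℕ.* (n ∸ k) !)) (nCk≡n!/k![n-k]! k≤n))
    (ℕ.m/n*n≡m (k![n∸k]!∣n! k≤n))
    where instance _ = k ℕ.!* (n ∸ k) !≢0

  -- Turns the factor that eˣ contributes to a Cauchy product into a binomial coefficient.
  n!*1/![n∸k] : ∀ {n k} → k ≤ n → ⟦ n ! ⟧ * 1/! (n ∸ k) ≡ ⟦ n C k ⟧ * ⟦ k ! ⟧
  n!*1/![n∸k] {n} {k} k≤n = begin
    ⟦ n ! ⟧ * 1/! (n ∸ k)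
      ≡⟨ cong (λ a → ⟦ a ⟧ * 1/! (n ∸ k)) (C*k!*[n∸k]!≡n! k≤n) ⟨
    ⟦ (n C k) ℕ.* (k ! ℕ.* (n ∸ k) !) ⟧ * 1/! (n ∸ k)
      ≡⟨ cong (_* 1/! (n ∸ k)) (trans (⟦⟧-homo-* (n C k) _) (cong (⟦ n C k ⟧ *_) (⟦⟧-homo-* (k !) _))) ⟩
    ⟦ n C k ⟧ * (⟦ k ! ⟧ * ⟦ (n ∸ k) ! ⟧) * 1/! (n ∸ k)
      ≡⟨ solve 4 (λ a b c d → a :* (b :* c) :* d := a :* b :* (c :* d)) refl
           ⟦ n C k ⟧ ⟦ k ! ⟧ ⟦ (n ∸ k) ! ⟧ (1/! (n ∸ k)) ⟩
    ⟦ n C k ⟧ * ⟦ k ! ⟧ * (⟦ (n ∸ k) ! ⟧ * 1/! (n ∸ k))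
      ≡⟨ cong (⟦ n C k ⟧ * ⟦ k ! ⟧ *_) (1/!-inverse (n ∸ k)) ⟩
    ⟦ n C k ⟧ * ⟦ k ! ⟧ * 1ℚ
      ≡⟨ ℚ.*-identityʳ _ ⟩
    ⟦ n C k ⟧ * ⟦ k ! ⟧ ∎

  sum-zero : ∀ {n} {t : Vector ℚ n} → (∀ i → t i ≡ 0ℚ) → sum t ≡ 0ℚ
  sum-zero {n} t≗0 = trans (sum-cong-≗ t≗0) (sum-replicate-zero n)

toℕ≤n : ∀ {n} (i : Fin (suc n)) → toℕ i ≤ n
toℕ≤n i = s≤s⁻¹ (toℕ<n i)

-- Formal differentiation and the powers of eˣ - 1.

module _ where
  open Series
  open ≡-Reasoning

  -- The formal derivative d/dx, read off on coefficients.
  D : Series → Series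
  D f n = ⟦ suc n ⟧ ℚ.* f (suc n)

  E : Series
  E = exp - 1#

  *-congˡ : ∀ f {g h} → g ≈ h → f * g ≈ f * h
  *-congˡ f g≈h n = sum-cong-≗ {suc n} λ i → cong (f (toℕ i) ℚ.*_) (g≈h (n ∸ toℕ i))

  *-congʳ : ∀ {f g} h → f ≈ g → f * h ≈ g * h
  *-congʳ h f≈g n = sum-cong-≗ {suc n} λ i → cong (ℚ._* h (n ∸ toℕ i)) (f≈g (toℕ i))

  *-distribˡ-+ : ∀ f g h → f * (g + h) ≈ f * g + f * h
  *-distribˡ-+ f g h n = trans
    (sum-cong-≗ {suc n} λ i → ℚ.*-distribˡ-+ (f (toℕ i)) (g (n ∸ toℕ i)) (h (n ∸ toℕ i)))
    (∑-distrib-+ {suc n} (λ i → f (toℕ i) ℚ.* g (n ∸ toℕ i)) (λ i → f (toℕ i) ℚ.* h (n ∸ toℕ i)))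

  *-distribʳ-+ : ∀ f g h → (g + h) * f ≈ g * f + h * f
  *-distribʳ-+ f g h n = trans
    (sum-cong-≗ {suc n} λ i → ℚ.*-distribʳ-+ (f (n ∸ toℕ i)) (g (toℕ i)) (h (toℕ i)))
    (∑-distrib-+ {suc n} (λ i → g (toℕ i) ℚ.* f (n ∸ toℕ i)) (λ i → h (toℕ i) ℚ.* f (n ∸ toℕ i)))

  *-·-comm : ∀ c f g → f * (c · g) ≈ c · (f * g)
  *-·-comm c f g n = trans
    (sum-cong-≗ {suc n} λ i → x∙yz≈y∙xz (f (toℕ i)) c (g (n ∸ toℕ i)))
    (sym (*-distribˡ-sum {suc n} c (λ i → f (toℕ i) ℚ.* g (n ∸ toℕ i))))
    where
    open import Algebra.Properties.CommutativeSemigroup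
      (CommutativeRing.*-commutativeSemigroup ℚ.+-*-commutativeRing) using (x∙yz≈y∙xz)

  *-identityˡ : ∀ f → 1# * f ≈ f
  *-identityˡ f n = trans
    (cong₂ ℚ._+_ (ℚ.*-identityˡ (f n)) (sum-zero {n} λ i → ℚ.*-zeroˡ (f (n ∸ suc (toℕ i)))))
    (ℚ.+-identityʳ (f n))

  -- In the i-th term of the coefficient of xⁿ⁺¹ the factor n + 1 splits as i + (n + 1 - i). The
  -- first part gives `D f * g`, the second `f * D g`.
  leibniz : ∀ f g → D (f * g) ≈ D f * g + f * D g
  leibniz f g n = begin
    ⟦ suc n ⟧ ℚ.* (f * g) (suc n)
      ≡⟨ *-distribˡ-sum {suc (suc n)} ⟦ suc n ⟧ (λ i → f (toℕ i) ℚ.* g (suc n ∸ toℕ i)) ⟩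
    sum {suc (suc n)} (λ i → ⟦ suc n ⟧ ℚ.* (f (toℕ i) ℚ.* g (suc n ∸ toℕ i)))
      ≡⟨ sum-cong-≗ {suc (suc n)} split ⟩
    sum {suc (suc n)} (λ i → l i ℚ.+ r i)
      ≡⟨ ∑-distrib-+ {suc (suc n)} l r ⟩
    sum l ℚ.+ sum r
      ≡⟨ cong₂ ℚ._+_ sum-l sum-r ⟩
    (D f * g) n ℚ.+ (f * D g) n ∎
    where
    l r : Vector ℚ (suc (suc n))
    l i = ⟦ toℕ i ⟧ ℚ.* f (toℕ i) ℚ.* g (suc n ∸ toℕ i)
    r i = f (toℕ i) ℚ.* (⟦ suc n ∸ toℕ i ⟧ ℚ.* g (suc n ∸ toℕ i))

    split : ∀ i → ⟦ suc n ⟧ ℚ.* (f (toℕ i) ℚ.* g (suc n ∸ toℕ i)) ≡ l i ℚ.+ r i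
    split i = trans
      (cong (ℚ._* (f (toℕ i) ℚ.* g (suc n ∸ toℕ i)))
        (trans (cong ⟦_⟧ (sym (ℕ.m+[n∸m]≡n (toℕ≤n i)))) (⟦⟧-homo-+ (toℕ i) (suc n ∸ toℕ i))))
      (solve 4 (λ a b x y → (a :+ b) :* (x :* y) := a :* x :* y :+ x :* (b :* y)) refl
        ⟦ toℕ i ⟧ ⟦ suc n ∸ toℕ i ⟧ (f (toℕ i)) (g (suc n ∸ toℕ i)))

    -- The term i = 0 carries the factor 0; the tail of `l` is the Cauchy product by computation.
    sum-l : sum l ≡ (D f * g) n
    sum-l = trans
      (cong (ℚ._+ sum (tail l))
        (trans (cong (ℚ._* g (suc n)) (ℚ.*-zeroˡ (f 0))) (ℚ.*-zeroˡ (g (suc n)))))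
      (ℚ.+-identityˡ _)

    -- Here the vanishing term is the last one, i = n + 1. For i ≤ n, n + 1 - i is the successor of
    -- n - i, which exposes `D g`.
    init-r : ∀ i → init r i ≡ f (toℕ i) ℚ.* D g (n ∸ toℕ i)
    init-r i = cong₂ (λ a b → f a ℚ.* (⟦ b ⟧ ℚ.* g b)) (toℕ-inject₁ i)
      (trans (cong (suc n ∸_) (toℕ-inject₁ i)) (ℕ.+-∸-assoc 1 (toℕ≤n i)))

    last-r : last r ≡ 0ℚ
    last-r = trans
      (cong₂ (λ a b → f a ℚ.* (⟦ b ⟧ ℚ.* g b)) (toℕ-fromℕ (suc n))
        (trans (cong (suc n ∸_) (toℕ-fromℕ (suc n))) (ℕ.n∸n≡0 (suc n))))
      (trans (cong (f (suc n) ℚ.*_) (ℚ.*-zeroˡ (g 0))) (ℚ.*-zeroʳ (f (suc n))))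

    sum-r : sum r ≡ (f * D g) n
    sum-r = trans (sum-init-last r)
      (trans (cong₂ ℚ._+_ (sum-cong-≗ init-r) last-r) (ℚ.+-identityʳ _))

  D-E : D E ≈ exp
  D-E n = trans (cong (⟦ suc n ⟧ ℚ.*_) (ℚ.+-identityʳ (1/! (suc n)))) (suc*1/! n)

  exp≈E+1 : exp ≈ E + 1#
  exp≈E+1 n = solve 2 (λ a b → a := a :- b :+ b) refl (1/! n) (1# n)

  exp* : ∀ f → exp * f ≈ E * f + f
  exp* f n = trans (*-congʳ f exp≈E+1 n)
    (trans (*-distribʳ-+ f E 1# n) (cong ((E * f) n ℚ.+_) (*-identityˡ f n)))

  -- Mutual induction: the Leibniz rule for E · Eʲ leaves the term E · (Eʲ)′, which the second
  -- statement evaluates. Keeping the factor E there gives a formula that also makes sense at j = 0,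
  -- where no power Eʲ⁻¹ is available.
  D-E^ : ∀ j → D (E ^ suc j) ≈ ⟦ suc j ⟧ · (exp * E ^ j)
  E*D-E^ : ∀ j → E * D (E ^ j) ≈ ⟦ j ⟧ · (exp * E ^ j)

  D-E^ j n = begin
    D (E * E ^ j) n
      ≡⟨ leibniz E (E ^ j) n ⟩
    (D E * E ^ j) n ℚ.+ (E * D (E ^ j)) n
      ≡⟨ cong₂ ℚ._+_ (*-congʳ (E ^ j) D-E n) (E*D-E^ j n) ⟩
    (exp * E ^ j) n ℚ.+ ⟦ j ⟧ ℚ.* (exp * E ^ j) n
      ≡⟨ solve 2 (λ a x → x :+ a :* x := (con 1ℚ :+ a) :* x) refl ⟦ j ⟧ ((exp * E ^ j) n) ⟩
    (⟦ 1 ⟧ ℚ.+ ⟦ j ⟧) ℚ.* (exp * E ^ j) n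
      ≡⟨ cong (ℚ._* (exp * E ^ j) n) (⟦⟧-homo-+ 1 j) ⟨
    ⟦ suc j ⟧ ℚ.* (exp * E ^ j) n ∎

  E*D-E^ zero n = trans
    (sum-zero {suc n} λ i → trans
      (cong (E (toℕ i) ℚ.*_) (ℚ.*-zeroʳ ⟦ suc (n ∸ toℕ i) ⟧)) (ℚ.*-zeroʳ (E (toℕ i))))
    (sym (ℚ.*-zeroˡ ((exp * 1#) n)))
  E*D-E^ (suc j) n = begin
    (E * D (E ^ suc j)) n                        ≡⟨ *-congˡ E (D-E^ j) n ⟩
    (E * (⟦ suc j ⟧ · (exp * E ^ j))) n          ≡⟨ *-·-comm ⟦ suc j ⟧ E (exp * E ^ j) n ⟩
    ⟦ suc j ⟧ ℚ.* (E * (exp * E ^ j)) n          ≡⟨ cong (⟦ suc j ⟧ ℚ.*_) (E*exp n) ⟩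
    ⟦ suc j ⟧ ℚ.* (exp * E ^ suc j) n            ∎
    where
    -- With eˣ = E + 1, both sides expand to E · Eʲ⁺¹ + Eʲ⁺¹.
    E*exp : E * (exp * E ^ j) ≈ exp * E ^ suc j
    E*exp m = begin
      (E * (exp * E ^ j)) m                      ≡⟨ *-congˡ E (exp* (E ^ j)) m ⟩
      (E * (E ^ suc j + E ^ j)) m                ≡⟨ *-distribˡ-+ E (E ^ suc j) (E ^ j) m ⟩
      (E * E ^ suc j) m ℚ.+ (E ^ suc j) m        ≡⟨ exp* (E ^ suc j) m ⟨
      (exp * E ^ suc j) m                        ∎

  -- E has constant coefficient 0, so the first term of E · Eᵏ drops out. Every other term takes a
  -- coefficient of Eᵏ at an index below n, hence below k, and the induction applies.
  E^-order : ∀ {n} k → n < k → (E ^ k) n ≡ 0ℚ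
  E^-order {n} (suc k) n<1+k = cong₂ ℚ._+_ (ℚ.*-zeroˡ ((E ^ k) n)) (sum-zero {n} λ i →
    trans (cong (E (suc (toℕ i)) ℚ.*_)
            (E^-order k (ℕ.<-≤-trans (ℕ.∸-monoʳ-< (s≤s z≤n) (toℕ<n i)) (s≤s⁻¹ n<1+k))))
          (ℚ.*-zeroʳ (E (suc (toℕ i)))))

  -- Surjection numbers and their binomial recurrence.

  *-comm : ∀ f g → f * g ≈ g * f
  *-comm f g n = trans
    (sum-permute {suc n} (λ i → f (toℕ i) ℚ.* g (n ∸ toℕ i)) reverse)
    (sum-cong-≗ {suc n} λ i → trans
      (cong₂ (λ a b → f a ℚ.* g b) (opposite-prop i)
        (trans (cong (n ∸_) (opposite-prop i)) (ℕ.m∸[m∸n]≡n (toℕ≤n i))))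
      (ℚ.*-comm (f (n ∸ toℕ i)) (g (toℕ i))))

  -- {n k} k!, the number of surjections from an n-set onto a k-set.
  surj : ℕ → ℕ → ℚ
  surj n k = stirling n k ℚ.* ⟦ k ! ⟧

  -- The factor k! cancels the 1/k! in the generating function of the Stirling numbers.
  surj≡n!*E^ : ∀ n k → surj n k ≡ ⟦ n ! ⟧ ℚ.* (E ^ k) n
  surj≡n!*E^ n k = begin
    ⟦ n ! ⟧ ℚ.* (1/! k ℚ.* (E ^ k) n) ℚ.* ⟦ k ! ⟧
      ≡⟨ solve 4 (λ a b c d → a :* (b :* c) :* d := d :* b :* (a :* c)) refl
           ⟦ n ! ⟧ (1/! k) ((E ^ k) n) ⟦ k ! ⟧ ⟩
    ⟦ k ! ⟧ ℚ.* 1/! k ℚ.* (⟦ n ! ⟧ ℚ.* (E ^ k) n)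
      ≡⟨ cong (ℚ._* (⟦ n ! ⟧ ℚ.* (E ^ k) n)) (1/!-inverse k) ⟩
    1ℚ ℚ.* (⟦ n ! ⟧ ℚ.* (E ^ k) n)
      ≡⟨ ℚ.*-identityˡ _ ⟩
    ⟦ n ! ⟧ ℚ.* (E ^ k) n ∎

  surj-zero : ∀ {n k} → n < k → surj n k ≡ 0ℚ
  surj-zero {n} {k} n<k = trans (surj≡n!*E^ n k)
    (trans (cong (⟦ n ! ⟧ ℚ.*_) (E^-order k n<k)) (ℚ.*-zeroʳ ⟦ n ! ⟧))

  -- E⁰ = 1 has no coefficient in positive degree.
  surj-suc-zero : ∀ n → surj (suc n) 0 ≡ 0ℚ
  surj-suc-zero n = trans (surj≡n!*E^ (suc n) 0) (ℚ.*-zeroʳ ⟦ suc n ! ⟧)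

  -- A product of exponential generating functions is a binomial convolution; the sequence belonging
  -- to eˣ is constantly 1.
  n!*exp* : ∀ f n → ⟦ n ! ⟧ ℚ.* (exp * f) n ≡
    sum {suc n} λ k → ⟦ n C toℕ k ⟧ ℚ.* (⟦ toℕ k ! ⟧ ℚ.* f (toℕ k))
  n!*exp* f n = begin
    ⟦ n ! ⟧ ℚ.* (exp * f) n
      -- With eˣ on the right, the summation index is the index of the coefficient of `f`.
      ≡⟨ cong (⟦ n ! ⟧ ℚ.*_) (*-comm exp f n) ⟩
    ⟦ n ! ⟧ ℚ.* (f * exp) n
      ≡⟨ *-distribˡ-sum {suc n} ⟦ n ! ⟧ (λ k → f (toℕ k) ℚ.* 1/! (n ∸ toℕ k)) ⟩
    sum {suc n} (λ k → ⟦ n ! ⟧ ℚ.* (f (toℕ k) ℚ.* 1/! (n ∸ toℕ k)))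
      ≡⟨ sum-cong-≗ {suc n} (λ k → term (toℕ≤n k)) ⟩
    sum {suc n} (λ k → ⟦ n C toℕ k ⟧ ℚ.* (⟦ toℕ k ! ⟧ ℚ.* f (toℕ k))) ∎
    where
    term : ∀ {k} → k ≤ n →
      ⟦ n ! ⟧ ℚ.* (f k ℚ.* 1/! (n ∸ k)) ≡ ⟦ n C k ⟧ ℚ.* (⟦ k ! ⟧ ℚ.* f k)
    term {k} k≤n = begin
      ⟦ n ! ⟧ ℚ.* (f k ℚ.* 1/! (n ∸ k))
        ≡⟨ solve 3 (λ a b c → a :* (b :* c) := a :* c :* b) refl ⟦ n ! ⟧ (f k) (1/! (n ∸ k)) ⟩
      ⟦ n ! ⟧ ℚ.* 1/! (n ∸ k) ℚ.* f k
        ≡⟨ cong (ℚ._* f k) (n!*1/![n∸k] k≤n) ⟩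
      ⟦ n C k ⟧ ℚ.* ⟦ k ! ⟧ ℚ.* f k
        ≡⟨ ℚ.*-assoc ⟦ n C k ⟧ ⟦ k ! ⟧ (f k) ⟩
      ⟦ n C k ⟧ ℚ.* (⟦ k ! ⟧ ℚ.* f k) ∎

  -- This is n! times the coefficient of xⁿ in `D-E^`: in (n + 1)! = (n + 1) · n! the factor n + 1
  -- is the one that `D` supplies.
  surj-suc-suc : ∀ n j → surj (suc n) (suc j) ≡
    sum {suc n} λ k → ⟦ n C toℕ k ⟧ ℚ.* (⟦ suc j ⟧ ℚ.* surj (toℕ k) j)
  surj-suc-suc n j = begin
    surj (suc n) (suc j)
      ≡⟨ surj≡n!*E^ (suc n) (suc j) ⟩
    ⟦ suc n ! ⟧ ℚ.* (E ^ suc j) (suc n)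
      ≡⟨ cong (ℚ._* (E ^ suc j) (suc n)) (⟦⟧-homo-* (suc n) (n !)) ⟩
    ⟦ suc n ⟧ ℚ.* ⟦ n ! ⟧ ℚ.* (E ^ suc j) (suc n)
      ≡⟨ solve 3 (λ a b c → a :* b :* c := b :* (a :* c)) refl
           ⟦ suc n ⟧ ⟦ n ! ⟧ ((E ^ suc j) (suc n)) ⟩
    ⟦ n ! ⟧ ℚ.* D (E ^ suc j) n
      ≡⟨ cong (⟦ n ! ⟧ ℚ.*_) (D-E^ j n) ⟩
    ⟦ n ! ⟧ ℚ.* (⟦ suc j ⟧ ℚ.* (exp * E ^ j) n)
      ≡⟨ solve 3 (λ a b c → a :* (b :* c) := b :* (a :* c)) refl
           ⟦ n ! ⟧ ⟦ suc j ⟧ ((exp * E ^ j) n) ⟩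
    ⟦ suc j ⟧ ℚ.* (⟦ n ! ⟧ ℚ.* (exp * E ^ j) n)
      ≡⟨ cong (⟦ suc j ⟧ ℚ.*_) (n!*exp* (E ^ j) n) ⟩
    ⟦ suc j ⟧ ℚ.* sum {suc n} (λ k → ⟦ n C toℕ k ⟧ ℚ.* (⟦ toℕ k ! ⟧ ℚ.* (E ^ j) (toℕ k)))
      ≡⟨ *-distribˡ-sum {suc n} ⟦ suc j ⟧ (λ k → ⟦ n C toℕ k ⟧ ℚ.* (⟦ toℕ k ! ⟧ ℚ.* (E ^ j) (toℕ k))) ⟩
    sum {suc n} (λ k → ⟦ suc j ⟧ ℚ.* (⟦ n C toℕ k ⟧ ℚ.* (⟦ toℕ k ! ⟧ ℚ.* (E ^ j) (toℕ k))))
      ≡⟨ sum-cong-≗ {suc n} (λ k → trans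
           (solve 3 (λ a b c → a :* (b :* c) := b :* (a :* c)) refl
             ⟦ suc j ⟧ ⟦ n C toℕ k ⟧ (⟦ toℕ k ! ⟧ ℚ.* (E ^ j) (toℕ k)))
           (cong (λ a → ⟦ n C toℕ k ⟧ ℚ.* (⟦ suc j ⟧ ℚ.* a)) (sym (surj≡n!*E^ (toℕ k) j)))) ⟩
    sum {suc n} (λ k → ⟦ n C toℕ k ⟧ ℚ.* (⟦ suc j ⟧ ℚ.* surj (toℕ k) j)) ∎

-- Coefficients of polynomials.

open Poly hiding (sum)

coeff-+ : ∀ p q i → coeff (p + q) i ≡ coeff p i ℚ.+ coeff q i
coeff-+ []      q       i       = sym (ℚ.+-identityˡ (coeff q i))
coeff-+ (a ∷ p) []      i       = sym (ℚ.+-identityʳ (coeff (a ∷ p) i))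
coeff-+ (a ∷ p) (b ∷ q) zero    = refl
coeff-+ (a ∷ p) (b ∷ q) (suc i) = coeff-+ p q i

coeff-· : ∀ c p i → coeff (c · p) i ≡ c ℚ.* coeff p i
coeff-· c []      i       = sym (ℚ.*-zeroʳ c)
coeff-· c (a ∷ p) zero    = refl
coeff-· c (a ∷ p) (suc i) = coeff-· c p i

coeff-sum : ∀ {n} (p : Fin n → Poly) i → coeff (Poly.sum p) i ≡ sum λ k → coeff (p k) i
coeff-sum {zero}  p i = refl
coeff-sum {suc n} p i = trans (coeff-+ (p zero) (Poly.sum (p ∘ suc)) i)
  (cong (coeff (p zero) i ℚ.+_) (coeff-sum (p ∘ suc) i))

-- The product unfolds to 0 · p plus a shifted 1 · p, with a stray zero added, so the lists may
-- differ in trailing zeros and the comparison is coefficientwise.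
X*≈0∷ : ∀ p → X * p ≈ 0ℚ ∷ p
X*≈0∷ p i = trans (coeff-+ (0ℚ · p) _ i) (trans
  (cong₂ ℚ._+_ (trans (coeff-· 0ℚ p i) (ℚ.*-zeroˡ (coeff p i))) (1*p i))
  (ℚ.+-identityˡ _))
  where
  1*p : ∀ i → coeff (0ℚ ∷ 1# * p) i ≡ coeff (0ℚ ∷ p) i
  1*p zero    = refl
  1*p (suc i) = trans (coeff-+ (1ℚ · p) (0ℚ ∷ []) i) (trans
    (cong₂ ℚ._+_ (trans (coeff-· 1ℚ p i) (ℚ.*-identityˡ (coeff p i))) (0∷[] i))
    (ℚ.+-identityʳ (coeff p i)))
    where
    0∷[] : ∀ i → coeff (0ℚ ∷ []) i ≡ 0ℚ
    0∷[] zero    = refl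
    0∷[] (suc i) = refl

-- The offset `m` is general because the recursion raises it by one while the index drops by one.
coeff-diffFrom : ∀ m p i → coeff (diffFrom m p) i ≡ ⟦ m ℕ.+ i ⟧ ℚ.* coeff p i
coeff-diffFrom m []      i       = sym (ℚ.*-zeroʳ ⟦ m ℕ.+ i ⟧)
coeff-diffFrom m (a ∷ p) zero    = cong (λ k → ⟦ k ⟧ ℚ.* a) (sym (ℕ.+-identityʳ m))
coeff-diffFrom m (a ∷ p) (suc i) = trans (coeff-diffFrom (suc m) p i)
  (cong (λ k → ⟦ k ⟧ ℚ.* coeff p i) (sym (ℕ.+-suc m i)))

coeff-derivative : ∀ p i → coeff (derivative p) i ≡ ⟦ suc i ⟧ ℚ.* coeff p (suc i)
coeff-derivative []      i = sym (ℚ.*-zeroʳ ⟦ suc i ⟧)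
coeff-derivative (a ∷ p) i = coeff-diffFrom 1 p i

coeff-X*derivative : ∀ p i → coeff (X * derivative p) i ≡ ⟦ i ⟧ ℚ.* coeff p i
coeff-X*derivative p zero    = trans (X*≈0∷ (derivative p) 0) (sym (ℚ.*-zeroˡ (coeff p 0)))
coeff-X*derivative p (suc i) = trans (X*≈0∷ (derivative p) (suc i)) (coeff-derivative p i)

coeff-p+X*derivative : ∀ p i → coeff (p + X * derivative p) i ≡ ⟦ suc i ⟧ ℚ.* coeff p i
coeff-p+X*derivative p i = begin
  coeff (p + X * derivative p) i             ≡⟨ coeff-+ p (X * derivative p) i ⟩
  coeff p i ℚ.+ coeff (X * derivative p) i   ≡⟨ cong (coeff p i ℚ.+_) (coeff-X*derivative p i) ⟩
  coeff p i ℚ.+ ⟦ i ⟧ ℚ.* coeff p i          ≡⟨ solve 2 (λ a x → x :+ a :* x := (con 1ℚ :+ a) :* x) refl ⟦ i ⟧ (coeff p i) ⟩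
  (⟦ 1 ⟧ ℚ.+ ⟦ i ⟧) ℚ.* coeff p i            ≡⟨ cong (ℚ._* coeff p i) (⟦⟧-homo-+ 1 i) ⟨
  ⟦ suc i ⟧ ℚ.* coeff p i                    ∎
  where
  open ≡-Reasoning

-- Only the term k = j contributes, since Xᵏ has a single nonzero coefficient. If j ≥ m that term is
-- missing, and the hypothesis makes `c j` zero as well. The induction shifts `c` and j together, as
-- Xᵏ⁺¹ = X · Xᵏ.
sum-coeff-X^ : ∀ m (c : ℕ → ℚ) → (∀ {j} → m ≤ j → c j ≡ 0ℚ) →
  ∀ j → sum {m} (λ k → c (toℕ k) ℚ.* coeff (X ^ toℕ k) j) ≡ c j
sum-coeff-X^ zero    c c≡0 j       = sym (c≡0 z≤n)
sum-coeff-X^ (suc m) c c≡0 zero    = trans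
  (cong₂ ℚ._+_ (ℚ.*-identityʳ (c 0)) (sum-zero {m} λ k →
    trans (cong (c (suc (toℕ k)) ℚ.*_) (X*≈0∷ (X ^ toℕ k) 0)) (ℚ.*-zeroʳ (c (suc (toℕ k))))))
  (ℚ.+-identityʳ (c 0))
sum-coeff-X^ (suc m) c c≡0 (suc j) = trans
  (cong₂ ℚ._+_ (ℚ.*-zeroʳ (c 0)) (trans
    (sum-cong-≗ {m} λ k → cong (c (suc (toℕ k)) ℚ.*_) (X*≈0∷ (X ^ toℕ k) (suc j)))
    (sum-coeff-X^ m (c ∘ suc) (c≡0 ∘ s≤s) j)))
  (ℚ.+-identityˡ (c (suc j)))

-- Comparison of coefficients in the recurrence.

-- Valid also for j > n, where both sides vanish. The final sum uses this range: there j is fixed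
-- while k runs from 0 to n.
coeff-F : ∀ n j → coeff (F n) j ≡ surj n j
coeff-F n j = trans (coeff-sum {suc n} (λ k → surj n (toℕ k) · X ^ toℕ k) j) (trans
  (sum-cong-≗ {suc n} λ k → coeff-· (surj n (toℕ k)) (X ^ toℕ k) j)
  (sum-coeff-X^ (suc n) (surj n) surj-zero j))

proposition12 : ∀ (n : ℕ) →
    F (suc n) ≈ X * (∑[ k ≤ n ] fromℕ (n C k) · (F k + X * F′ k))
-- Both constant coefficients are 0: the right-hand side is a multiple of X.
proposition12 n zero    = trans (coeff-F (suc n) 0) (trans (surj-suc-zero n)
  (sym (X*≈0∷ (∑[ k ≤ n ] ⟦ n C k ⟧ · (F k + X * F′ k)) 0)))
-- The outer factor X lowers the index to j, where `p + X * derivative p` contributes the factor j +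
-- 1 of `surj-suc-suc`.
proposition12 n (suc j) = begin
  coeff (F (suc n)) (suc j)
    ≡⟨ coeff-F (suc n) (suc j) ⟩
  surj (suc n) (suc j)
    ≡⟨ surj-suc-suc n j ⟩
  sum {suc n} (λ k → ⟦ n C toℕ k ⟧ ℚ.* (⟦ suc j ⟧ ℚ.* surj (toℕ k) j))
    ≡⟨ sum-cong-≗ {suc n} (λ k → cong (λ a → ⟦ n C toℕ k ⟧ ℚ.* (⟦ suc j ⟧ ℚ.* a)) (coeff-F (toℕ k) j)) ⟨
  sum {suc n} (λ k → ⟦ n C toℕ k ⟧ ℚ.* (⟦ suc j ⟧ ℚ.* coeff (F (toℕ k)) j))
    ≡⟨ sum-cong-≗ {suc n} (λ k → trans (coeff-· ⟦ n C toℕ k ⟧ (summand (toℕ k)) j)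
         (cong (⟦ n C toℕ k ⟧ ℚ.*_) (coeff-p+X*derivative (F (toℕ k)) j))) ⟨
  sum {suc n} (λ k → coeff (⟦ n C toℕ k ⟧ · summand (toℕ k)) j)
    ≡⟨ coeff-sum {suc n} (λ k → ⟦ n C toℕ k ⟧ · summand (toℕ k)) j ⟨
  coeff (∑[ k ≤ n ] ⟦ n C k ⟧ · summand k) j
    ≡⟨ X*≈0∷ (∑[ k ≤ n ] ⟦ n C k ⟧ · summand k) (suc j) ⟨
  coeff (X * (∑[ k ≤ n ] ⟦ n C k ⟧ · summand k)) (suc j) ∎
  where
  open ≡-Reasoning
  summand : ℕ → Poly
  summand k = F k + X * F′ k
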